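{- Let $A$ be a meet-semilattice and $\kappa$ a regular cardinal. Then $A$ is a $\kappa$-frame if and only if $\mathcal{BL}_\kappa A=A$.
   Context: A meet-semilattice is a poset with all finite meets. An existing join $\bigvee S$ is distributive if $a\wedge\bigvee S=\bigvee\{a\wedge s:s\in S\}$ for all $a$. A D-ideal of $A$ is a downset containing $\bigvee S$ for each subset $S$ of it with distributive join; $\mathcal{BL} A$ is the frame of D-ideals ordered by inclusion, and $A$ is identified with the sub-meet-semilattice $\{{\downarrow}a:a\in A\}$ of $\mathcal{BL} A$. A $\kappa$-join is a join of fewer than $\kappa$ elements; $A$ is a $\kappa$-frame if all $\kappa$-joins exist in $A$ and are distributive. $\mathcal{BL}_\kappa A$ is the sub-$\kappa$-frame of $\mathcal{BL} A$ generated by $A$ (the smallest subset containing $A$ closed under finite meets and $\kappa$-joins computed in $\mathcal{BL} A$). -}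

module Defs where

open import Level using (Level; suc; _⊔_; Lift; lift; lower)
open import Data.List.Base using (List)
open import Data.List.Membership.Propositional using () renaming (_∈_ to _∈ₗ_)
open import Data.Nat.Base using (ℕ)
open import Data.Product using (Σ; ∃; ∃-syntax; _×_; _,_; proj₁)
open import Function.Bundles using (Func; Injection; Inverse)
open import Induction.WellFounded using (WellFounded)
open import Relation.Binary.Bundles using (Poset; Setoid; StrictTotalOrder)
open import Relation.Binary.Lattice.Bundles using (BoundedMeetSemilattice)
import Relation.Binary.Construct.On as On
import Relation.Binary.PropositionalEquality as ≡
open import Relation.Nullary using (¬_)
open import Relation.Unary using (Pred; _∈_; _⊆_; _≐_)
open import Relation.Unary.Properties using (⊆-reflexive; ≐-refl; ≐-sym; ≐-trans)

-- A regular cardinal, presented as an initial ordinal: a well-ordered set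
-- equipotent to none of its proper initial segments.  Regularity is
-- cf κ = κ: no function from a smaller ordinal into κ is cofinal.
record RegularCardinal (ℓ : Level) : Set (suc ℓ) where
  field
    order : StrictTotalOrder ℓ ℓ ℓ

  open StrictTotalOrder order public
    using (Carrier; _<_) renaming (module Eq to OrderEq)

  setoid : Setoid ℓ ℓ
  setoid = OrderEq.setoid

  segment : Carrier → Setoid ℓ ℓ
  segment α = On.setoid {B = ∃[ β ] β < α} setoid proj₁

  field
    wellFounded : WellFounded _<_
    initial     : ∀ α → ¬ Inverse (segment α) setoid
    infinite    : Injection (≡.setoid ℕ) setoid
    regular     : ∀ α (f : Func (segment α) setoid) →
                  ∃[ γ ] ∀ β → Func.to f β < γ

-- Since κ is an initial ordinal, a set has fewer than κ elements exactly when
-- it is equipotent to the segment below some α in κ.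
FewerThan : ∀ {ℓ a b} → RegularCardinal ℓ → Setoid a b → Set (ℓ ⊔ a ⊔ b)
FewerThan κ X = ∃[ α ] Inverse (RegularCardinal.segment κ α) X

module _ {c ℓ₁ ℓ₂} (P : Poset c ℓ₁ ℓ₂) where
  open Poset P

  IsJoin : ∀ {s} → Pred Carrier s → Carrier → Set (c ⊔ ℓ₂ ⊔ s)
  IsJoin S x = (∀ {y} → y ∈ S → y ≤ x)
             × (∀ z → (∀ {y} → y ∈ S → y ≤ z) → x ≤ z)

  IsMeet : ∀ {s} → Pred Carrier s → Carrier → Set (c ⊔ ℓ₂ ⊔ s)
  IsMeet S x = (∀ {y} → y ∈ S → x ≤ y)
             × (∀ z → (∀ {y} → y ∈ S → z ≤ y) → z ≤ x)

  -- Elements of S are counted up to the equality of the poset.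
  subsetSetoid : ∀ {s} → Pred Carrier s → Setoid (c ⊔ s) ℓ₁
  subsetSetoid S = On.setoid {B = Σ Carrier S} Eq.setoid proj₁

module _ {ℓ} (A : BoundedMeetSemilattice ℓ ℓ ℓ) where
  open BoundedMeetSemilattice A

  meetWith : Carrier → Pred Carrier ℓ → Pred Carrier ℓ
  meetWith a S y = ∃[ s ] s ∈ S × y ≈ a ∧ s

  IsDistributiveJoin : Pred Carrier ℓ → Carrier → Set ℓ
  IsDistributiveJoin S x =
    IsJoin poset S x × (∀ a → IsJoin poset (meetWith a S) (a ∧ x))

  -- Subsets of A are predicates valued in Set ℓ.  D-ideals are valued one
  -- level up because the D-ideal generated by a subset quantifies over subsets
  -- of A; this is what makes joins of D-ideals exist without resizing, and
  -- classically the two levels describe the same subsets.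
  record DIdeal : Set (suc (suc ℓ)) where
    field
      members    : Pred Carrier (suc ℓ)
      downClosed : ∀ {x y} → x ≤ y → y ∈ members → x ∈ members
      joinClosed : ∀ (S : Pred Carrier ℓ) {x} → S ⊆ members →
                   IsDistributiveJoin S x → x ∈ members
  open DIdeal

  BL : Poset (suc (suc ℓ)) (suc ℓ) (suc ℓ)
  BL = record
    { Carrier = DIdeal
    ; _≈_ = λ I J → members I ≐ members J
    ; _≤_ = λ I J → members I ⊆ members J
    ; isPartialOrder = record
      { isPreorder = record
        { isEquivalence = record { refl = ≐-refl ; sym = ≐-sym ; trans = ≐-trans }
        ; reflexive = ⊆-reflexive
        ; trans = λ I⊆J J⊆K x∈I → J⊆K (I⊆J x∈I)
        }
      ; antisym = λ I⊆J J⊆I → I⊆J , J⊆I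
      }
    }

  ↓_ : Carrier → DIdeal
  ↓ a = record
    { members    = λ x → Lift (suc ℓ) (x ≤ a)
    ; downClosed = λ x≤y (lift y≤a) → lift (trans x≤y y≤a)
    ; joinClosed = λ { S S⊆↓a ((_ , least) , _) →
                       lift (least a λ y∈S → lower (S⊆↓a y∈S)) }
    }

  -- A, identified with a subset of BL A.
  Principal : Pred DIdeal (suc ℓ)
  Principal I = ∃[ a ] Poset._≈_ BL I (↓ a)

  module _ (κ : RegularCardinal ℓ) where

    IsκFrame : Set (suc ℓ)
    IsκFrame = ∀ (S : Pred Carrier ℓ) → FewerThan κ (subsetSetoid poset S) →
               ∃[ x ] IsDistributiveJoin S x

    -- Nothing is lost by fixing the levels of S and 𝒮 here and in IsκFrame:
    -- a subset with fewer than κ elements is the range of a family indexed by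
    -- a segment of κ, and such a range exists at these levels.
    data BLκ : Pred DIdeal (suc (suc ℓ)) where
      principal : ∀ {I} → I ∈ Principal → I ∈ BLκ
      meet : ∀ (Is : List DIdeal) {I} → (∀ {J} → J ∈ₗ Is → J ∈ BLκ) →
             IsMeet BL (_∈ₗ Is) I → I ∈ BLκ
      join : ∀ (𝒮 : Pred DIdeal (suc ℓ)) {I} → 𝒮 ⊆ BLκ →
             FewerThan κ (subsetSetoid BL 𝒮) → IsJoin BL 𝒮 I → I ∈ BLκ

{-# OPTIONS --safe #-}

-- A join in BL of principal ideals ↓s (s ∈ S) is the D-ideal generated by S, and
-- it equals ↓x exactly when x is a distributive join of S.  If x is such a join,
-- then ↓x is generated by S because D-ideals are closed under distributive joins.
-- Conversely, if x lies in every D-ideal containing S, apply this to the D-ideals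
-- ↓z and { y ∣ a ∧ y ≤ z }: the former shows that x is the join of S, the latter
-- that this join is distributive.

module Submission where

open import Level using (Level; Lift; suc; lift; lower)
open import Data.List.Base using (List; []; _∷_)
open import Data.List.Membership.Propositional using () renaming (_∈_ to _∈ₗ_)
open import Data.List.Relation.Unary.Any using (here; there)
open import Data.Product using (Σ; ∃-syntax; _×_; _,_; proj₁; proj₂)
open import Function.Base using (_∘_)
open import Function.Bundles using (_⇔_; Inverse; mk⇔)
import Function.Construct.Composition as Composition
open import Relation.Binary.Bundles using (Poset)
open import Relation.Binary.Lattice.Bundles using (BoundedMeetSemilattice)
import Relation.Binary.Lattice.Properties.MeetSemilattice as MeetSemilatticeProperties
import Relation.Binary.PropositionalEquality as ≡
open import Relation.Unary using (Pred; _∈_; _⊆_; _≐_)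
open import Relation.Unary.Properties using (≐-refl; ≐-sym; ≐-trans)
open import Defs

module _ {c ℓ₁ ℓ₂} (P : Poset c ℓ₁ ℓ₂) where
  open Poset P

  meet-unique : ∀ {s} {S : Pred Carrier s} {x y} → IsMeet P S x → IsMeet P S y → x ≈ y
  meet-unique (x-lower , x-greatest) (y-lower , y-greatest) =
    antisym (y-greatest _ x-lower) (x-greatest _ y-lower)

module _ {ℓ} (A : BoundedMeetSemilattice ℓ ℓ ℓ) where
  open BoundedMeetSemilattice A
  open MeetSemilatticeProperties meetSemilattice using (∧-monotonic)
  open DIdeal
  private module BL = Poset (BL A)

  ↓-mono : ∀ {a b} → a ≤ b → (↓_ A a) BL.≤ (↓_ A b)
  ↓-mono a≤b (lift x≤a) = lift (trans x≤a a≤b)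

  ↓-cong : ∀ {a b} → a ≈ b → (↓_ A a) BL.≈ (↓_ A b)
  ↓-cong a≈b = ↓-mono (reflexive a≈b) , ↓-mono (reflexive (Eq.sym a≈b))

  ↓-injective : ∀ {a b} → (↓_ A a) BL.≈ (↓_ A b) → a ≈ b
  ↓-injective (a⊆b , b⊆a) = antisym (lower (a⊆b (lift refl))) (lower (b⊆a (lift refl)))

  ↓-least : ∀ {a} (I : DIdeal A) → a ∈ members I → (↓_ A a) BL.≤ I
  ↓-least I a∈I (lift x≤a) = downClosed I x≤a a∈I

  -- Induction on the list: the empty meet is `↓ ⊤`, and the principal ideals of `a` and `b`
  -- intersect in that of `a ∧ b`.
  finiteMeet-principal : (Is : List (DIdeal A)) → (∀ {J} → J ∈ₗ Is → J ∈ Principal A) →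
                         ∃[ a ] IsMeet (BL A) (_∈ₗ Is) (↓_ A a)
  finiteMeet-principal []       _  = ⊤ , (λ ()) , λ _ _ _ → lift (maximum _)
  finiteMeet-principal (J ∷ Is) pr
    with a , J⊆↓a , ↓a⊆J ← pr (here ≡.refl)
    with b , b-lower , b-greatest ← finiteMeet-principal Is (pr ∘ there) =
    a ∧ b , lower-bound , λ K K⊆ y∈K →
      lift (∧-greatest (lower (J⊆↓a (K⊆ (here ≡.refl) y∈K)))
                       (lower (b-greatest K (λ J∈Is → K⊆ (there J∈Is)) y∈K)))
    where
    lower-bound : ∀ {K} → K ∈ₗ (J ∷ Is) → (↓_ A (a ∧ b)) BL.≤ K
    lower-bound (here ≡.refl) y≤a∧b = ↓a⊆J (↓-mono (x∧y≤x a b) y≤a∧b)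
    lower-bound (there K∈Is)  y≤a∧b = b-lower K∈Is (↓-mono (x∧y≤y a b) y≤a∧b)

  -- The Heyting implication from `↓ a` to `↓ z` in `BL A`. Closure under joins is where
  -- distributivity enters: `a ∧ x` is the least upper bound of the `a ∧ t`.
  residual : Carrier → Carrier → DIdeal A
  residual a z = record
    { members    = λ y → Lift (suc ℓ) (a ∧ y ≤ z)
    ; downClosed = λ x≤y (lift a∧y≤z) → lift (trans (∧-monotonic refl x≤y) a∧y≤z)
    ; joinClosed = λ { T T⊆ (_ , distributes) → lift (proj₂ (distributes a) z
        λ { (t , t∈T , y≈a∧t) → trans (reflexive y≈a∧t) (lower (T⊆ t∈T)) }) }
    }

  -- Generated inductively: the intersection of all D-ideals containing S
  -- would quantify over DIdeal, whose universe is too large.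
  data Generated (S : Pred Carrier ℓ) : Pred Carrier (suc ℓ) where
    base : ∀ {x} → x ∈ S → Generated S x
    down : ∀ {x y} → x ≤ y → Generated S y → Generated S x
    join : ∀ (T : Pred Carrier ℓ) {x} → T ⊆ Generated S →
           IsDistributiveJoin A T x → Generated S x

  generated : Pred Carrier ℓ → DIdeal A
  generated S = record { members = Generated S ; downClosed = down ; joinClosed = join }

  generated-least : ∀ {S} (I : DIdeal A) → S ⊆ members I → generated S BL.≤ I
  generated-least I S⊆I (base x∈S)     = S⊆I x∈S
  generated-least I S⊆I (down x≤y y∈)  = downClosed I x≤y (generated-least I S⊆I y∈)
  generated-least I S⊆I (join T T⊆ dj) =
    joinClosed I T (λ t∈T → generated-least I S⊆I (T⊆ t∈T)) dj

  principal⇒distributiveJoin : ∀ {S x} → generated S BL.≈ (↓_ A x) → IsDistributiveJoin A S x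
  principal⇒distributiveJoin {S} {x} (gen⊆↓x , ↓x⊆gen) =
    (upper , λ z S≤z → lower (x∈ (↓_ A z) (λ s∈S → lift (S≤z s∈S)))) ,
    λ a → (λ { (s , s∈S , y≈a∧s) → trans (reflexive y≈a∧s) (∧-monotonic refl (upper s∈S)) })
        -- That `z` bounds every `a ∧ s` says precisely that `S` lies inside `residual a z`.
        , λ z a∧S≤z → lower (x∈ (residual a z) λ s∈S → lift (a∧S≤z (_ , s∈S , Eq.refl)))
    where
    upper : ∀ {y} → y ∈ S → y ≤ x
    upper y∈S = lower (gen⊆↓x (base y∈S))

    x∈ : (I : DIdeal A) → S ⊆ members I → x ∈ members I
    x∈ I S⊆I = generated-least I S⊆I (↓x⊆gen (lift refl))

  -- Equality in `BL A` keeps this at level `suc ℓ`, as the `join` constructor of `BLκ` requires;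
  -- propositional equality of D-ideals would live one level higher.
  ↓-image : Pred Carrier ℓ → Pred (DIdeal A) (suc ℓ)
  ↓-image S I = ∃[ s ] s ∈ S × I BL.≈ (↓_ A s)

  ↓-image-inverse : ∀ S → Inverse (subsetSetoid poset S) (subsetSetoid (BL A) (↓-image S))
  ↓-image-inverse S = record
    { to        = λ (s , s∈S) → (↓_ A s) , s , s∈S , ≐-refl
    ; from      = λ (_ , s , s∈S , _) → s , s∈S
    ; to-cong   = ↓-cong
    ; from-cong = λ { {_ , _ , _ , I≈} {_ , _ , _ , J≈} I≈J →
                    ↓-injective (≐-trans (≐-sym I≈) (≐-trans I≈J J≈)) }
    ; inverse   = (λ { {_ , _ , _ , I≈} y≈ → ≐-trans (↓-cong y≈) (≐-sym I≈) })
                , (λ { {_} {_ , _ , _ , I≈} I≈↓ → ↓-injective (≐-trans (≐-sym I≈) I≈↓) })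
    }

  -- A D-ideal contains `↓ s` exactly when it contains `s`, so the upper bounds of the image are the
  -- D-ideals containing `S`.
  generated-join : ∀ S → IsJoin (BL A) (↓-image S) (generated S)
  generated-join S =
    (λ { (s , s∈S , I⊆↓s , _) y∈I → ↓-least (generated S) (base s∈S) (I⊆↓s y∈I) }) ,
    λ K ub → generated-least K λ {s} s∈S → ub {↓_ A s} (s , s∈S , ≐-refl) (lift refl)

  module _ (κ : RegularCardinal ℓ) where

    -- The generators of the members of `𝒮` form a set of fewer than κ elements, so they have a
    -- distributive join `x`. Then `↓ x` bounds `𝒮`, and `I` contains `x` because it is a D-ideal
    -- containing the generators.
    κJoin-principal : IsκFrame A κ → ∀ (𝒮 : Pred (DIdeal A) (suc ℓ)) {I} → 𝒮 ⊆ Principal A →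
                      FewerThan κ (subsetSetoid (BL A) 𝒮) → IsJoin (BL A) 𝒮 I →
                      I ∈ Principal A
    κJoin-principal frame 𝒮 {I} 𝒮⊆Principal (α , enum) (upper , least) =
      x , least (↓_ A x) 𝒮≤↓x , ↓-least I (joinClosed I S S⊆I isDJ)
      where
      open Inverse enum using (to; from; to-cong; from-cong; strictlyInverseˡ; strictlyInverseʳ)
      module Seg = RegularCardinal κ

      Index : Set ℓ
      Index = ∃[ β ] β Seg.< α

      gen : Index → Carrier
      gen β = proj₁ (𝒮⊆Principal (proj₂ (to β)))

      to≈↓gen : ∀ β → proj₁ (to β) BL.≈ (↓_ A (gen β))
      to≈↓gen β = proj₂ (𝒮⊆Principal (proj₂ (to β)))

      -- Indexed by the segment of κ instead of by `𝒮`, whose members live in too large a universe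
      -- for a predicate at level `ℓ`.
      S : Pred Carrier ℓ
      S y = Σ Index λ β → y ≈ gen β

      -- The generator is read off a membership proof, but a principal ideal determines it up to
      -- `≈`.
      gen-cong : ∀ {β γ} → proj₁ β Seg.OrderEq.≈ proj₁ γ → gen β ≈ gen γ
      gen-cong {β} {γ} β≈γ = ↓-injective
        (≐-trans (≐-sym (to≈↓gen β)) (≐-trans (to-cong β≈γ) (to≈↓gen γ)))

      gen-injective : ∀ {β γ} → gen β ≈ gen γ → proj₁ β Seg.OrderEq.≈ proj₁ γ
      gen-injective {β} {γ} eq = Seg.OrderEq.trans (Seg.OrderEq.sym (strictlyInverseʳ β))
        (Seg.OrderEq.trans (from-cong (≐-trans (to≈↓gen β)
          (≐-trans (↓-cong eq) (≐-sym (to≈↓gen γ))))) (strictlyInverseʳ γ))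

      S-enum : Inverse (Seg.segment α) (subsetSetoid poset S)
      S-enum = record
        { to        = λ β → gen β , β , Eq.refl
        ; from      = λ (_ , β , _) → β
        ; to-cong   = λ {β} {γ} → gen-cong {β} {γ}
        ; from-cong = λ { {_ , β , y≈} {_ , γ , z≈} y≈z →
                        gen-injective {β} {γ} (Eq.trans (Eq.sym y≈) (Eq.trans y≈z z≈)) }
        ; inverse   = (λ { {_ , γ , y≈} {β} β≈γ → Eq.trans (gen-cong {β} {γ} β≈γ) (Eq.sym y≈) })
                    , (λ { {β} {_ , γ , y≈} y≈β →
                         gen-injective {γ} {β} (Eq.trans (Eq.sym y≈) y≈β) })
        }

      x : Carrier
      x = proj₁ (frame S (α , S-enum))

      isDJ : IsDistributiveJoin A S x
      isDJ = proj₂ (frame S (α , S-enum))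

      S⊆I : S ⊆ members I
      S⊆I (β , y≈gen) = upper (proj₂ (to β)) (proj₂ (to≈↓gen β) (lift (reflexive y≈gen)))

      𝒮≤↓x : ∀ {J} → J ∈ 𝒮 → J BL.≤ (↓_ A x)
      -- `J` equals `to β` only up to equality in `BL A`, so `y` is carried through `to β` and
      -- `↓ (gen β)` before using `gen β ≤ x`.
      𝒮≤↓x {J} J∈𝒮 y∈J = ↓-mono (proj₁ (proj₁ isDJ) (β , Eq.refl))
        (proj₁ (to≈↓gen β) (proj₂ (strictlyInverseˡ (J , J∈𝒮)) y∈J))
        where
        β : Index
        β = from (J , J∈𝒮)

    -- Induction on the generation of `BLκ`: principal ideals are stable under finite meets, and
    -- under κ-joins by the hypothesis.
    κFrame⇒BLκ⊆Principal : IsκFrame A κ → BLκ A κ ⊆ Principal A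
    κFrame⇒BLκ⊆Principal frame (principal I∈) = I∈
    κFrame⇒BLκ⊆Principal frame {I} (meet Is Is⊆ isMeet)
      with a , isMeet′ ← finiteMeet-principal Is (λ J∈Is → κFrame⇒BLκ⊆Principal frame (Is⊆ J∈Is)) =
      a , meet-unique (BL A) {x = I} {y = ↓_ A a} isMeet isMeet′
    κFrame⇒BLκ⊆Principal frame {I} (join 𝒮 𝒮⊆ small isJoin) =
      κJoin-principal frame 𝒮 {I} (λ J∈𝒮 → κFrame⇒BLκ⊆Principal frame (𝒮⊆ J∈𝒮)) small isJoin

    κFrame⇒BLκ≐Principal : IsκFrame A κ → BLκ A κ ≐ Principal A
    κFrame⇒BLκ≐Principal frame = κFrame⇒BLκ⊆Principal frame , principal

    BLκ≐Principal⇒κFrame : BLκ A κ ≐ Principal A → IsκFrame A κ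
    BLκ≐Principal⇒κFrame (BLκ⊆Principal , _) S (α , enum)
      -- `generated S` is a κ-join of principal ideals, hence itself principal; its generator is the
      -- required join.
      with x , gen≈↓x ← BLκ⊆Principal {generated S} (join (↓-image S)
             (λ (s , _ , I≈↓s) → principal (s , I≈↓s))
             (α , Composition.inverse enum (↓-image-inverse S))
             (generated-join S)) =
      x , principal⇒distributiveJoin gen≈↓x

theorem4p2 : ∀ {ℓ : Level} (A : BoundedMeetSemilattice ℓ ℓ ℓ) (κ : RegularCardinal ℓ) →
    IsκFrame A κ ⇔ (BLκ A κ ≐ Principal A)
theorem4p2 A κ = mk⇔ (κFrame⇒BLκ≐Principal A κ) (BLκ≐Principal⇒κFrame A κ)
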